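{- Let $G$ be a finite simple graph with $n$ vertices $v_1,\dots,v_n$, and let $\bar{\bar{d}}(G)=\sqrt{\frac{d(v_1)^2+d(v_2)^2+\cdots+d(v_n)^2}{n}}$, where $d(v)$ denotes the degree of $v$. Then $$\varphi(G)\geq \frac{n}{n-\bar{\bar{d}}(G)}.$$ Moreover, equality holds if and only if $n\equiv 0 \pmod{\varphi(G)}$ and $G$ is a regular graph of degree $\frac{n(\varphi(G)-1)}{\varphi(G)}$.
   Context: All graphs are finite, undirected, without loops or multiple edges. For a graph $G$ with $n$ vertices, a set $V\subseteq V(G)$ is called a $\delta$-set in $G$ if $d(v)\leq n-|V|$ for every $v\in V$. The graph $G$ is called a generalized $r$-partite graph if there is a partition $V(G)=V_1\cup\dots\cup V_r$ into pairwise disjoint sets each of which is a $\delta$-set in $G$. The invariant $\varphi(G)$ is the smallest integer $r$ such that $G$ is a generalized $r$-partite graph. -}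

module Defs where

open import Data.Fin.Base using (Fin; zero; suc)
import Data.Fin.Properties as Fin
open import Data.Fin.Subset using (Subset; _∈_; _∩_; ∣_∣; ⁅_⁆; ⊤; Nonempty)
import Data.Fin.Subset.Properties as Sub
import Data.Integer.Base as ℤ
import Data.Integer.Properties as ℤₚ
open import Data.Nat.Base as ℕ using (ℕ; zero; suc; NonZero)
import Data.Nat.Properties as ℕₚ
open import Data.Product using (∃; ∃-syntax; _×_; _,_; proj₁; proj₂; uncurry)
open import Data.Rational.Base as ℚ
  using (ℚ; 0ℚ; 1ℚ; Positive; NonNegative; _/_; _<_; _≤_; _+_; _-_; _*_; -_)
open import Data.Rational.Properties
open import Data.Rational.Solver using (module +-*-Solver)
import Data.Rational.Unnormalised.Base as ℚᵘ
import Data.Rational.Unnormalised.Properties as ℚᵘₚ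
open import Data.Sum.Base using (_⊎_; inj₁; inj₂)
open import Data.Vec.Base as Vec using (Vec; []; _∷_; lookup; tabulate)
open import Data.Vec.Properties using (lookup∘tabulate; []=⇒lookup)
open import Function.Base using (_∘_)
open import Function.Bundles using (_⇔_; mk⇔; module Equivalence)
open import Level using (0ℓ)
open import Relation.Binary.Core using (Rel)
import Relation.Binary.Definitions as Binary
open import Relation.Binary.Definitions using (tri<; tri≈; tri>)
open import Relation.Binary.PropositionalEquality
open import Relation.Nullary
  using (Dec; yes; no; does; ¬_; ¬?; contradiction; _×-dec_; _→-dec_; map′)
open import Relation.Unary using (Pred; Decidable)

open +-*-Solver using (solve; _:+_; _:*_; _:=_; _:-_; :-_; con)

record Graph (n : ℕ) : Set₁ where
  field
    Adj     : Rel (Fin n) 0ℓ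
    adj?    : Binary.Decidable Adj
    symm    : Binary.Symmetric Adj
    irrefl  : ∀ {v} → ¬ Adj v v

module _ {n : ℕ} (G : Graph n) where
  open Graph G

  neighbours : Fin n → Subset n
  neighbours v = tabulate λ u → does (adj? v u)

  degree : Fin n → ℕ
  degree v = ∣ neighbours v ∣

  IsRegular : ℕ → Set
  IsRegular d = ∀ v → degree v ≡ d

  -- ∣ V ∣ ≤ n, so the monus is an honest difference.
  IsδSet : Subset n → Set
  IsδSet V = ∀ v → v ∈ V → degree v ℕ.≤ n ℕ.∸ ∣ V ∣

  -- Parts may be empty: discarding empty parts only decreases r, so this
  -- has no effect on φ.
  IsGeneralizedPartite : ℕ → Set
  IsGeneralizedPartite r = ∃[ V ]
      (∀ i → IsδSet (lookup {n = r} V i))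
    × (∀ v → ∃[ i ] v ∈ lookup V i)
    × (∀ i j → i ≢ j → ¬ Nonempty (lookup V i ∩ lookup V j))

IsLeast : Pred ℕ 0ℓ → ℕ → Set
IsLeast P r = P r × (∀ s → P s → r ℕ.≤ s)

least : ∀ {P : Pred ℕ 0ℓ} → Decidable P → ∃ P → ∃ (IsLeast P)
least P? (b , Pb) = search P? b Pb
  where
  search : ∀ {P : Pred ℕ 0ℓ} → Decidable P → (b : ℕ) → P b → ∃ (IsLeast P)
  search P? b Pb with P? 0
  search P? b       Pb | yes P0 = 0 , P0 , λ _ _ → ℕ.z≤n
  search P? zero    Pb | no ¬P0 = contradiction Pb ¬P0
  search {P} P? (suc b) Pb | no ¬P0 with search {P ∘ suc} (P? ∘ suc) b Pb
  ... | r , Pr , min = suc r , Pr , λ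
    { zero Ps → contradiction Ps ¬P0 ; (suc s) Ps → ℕ.s≤s (min s Ps) }

anyVec? : ∀ {n r} {P : Pred (Vec (Subset n) r) 0ℓ} →
          Decidable P → Dec (∃ P)
anyVec? {r = zero}  P? = map′ ([] ,_) (λ { ([] , p) → p }) (P? [])
anyVec? {r = suc r} P? =
  map′ (λ (x , xs , p) → x ∷ xs , p) (λ { (x ∷ xs , p) → x , xs , p })
       (Sub.anySubset? λ x → anyVec? λ xs → P? (x ∷ xs))

module _ {n : ℕ} (G : Graph n) where
  open Graph G

  isδSet? : Decidable (IsδSet G)
  isδSet? V = Fin.all? λ v →
    (v Sub.∈? V) →-dec (degree G v ℕₚ.≤? n ℕ.∸ ∣ V ∣)

  isGeneralizedPartite? : Decidable (IsGeneralizedPartite G)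
  isGeneralizedPartite? r = anyVec? λ V →
      Fin.all? (λ i → isδSet? (lookup V i))
    ×-dec Fin.all? (λ v → Fin.any? λ i → v Sub.∈? lookup V i)
    ×-dec Fin.all? (λ i → Fin.all? λ j →
      ¬? (i Fin.≟ j) →-dec ¬? (Sub.nonempty? (lookup V i ∩ lookup V j)))

  v∉neighbours : ∀ v → ¬ (v ∈ neighbours G v)
  v∉neighbours v v∈N with adj? v v | lookup∘tabulate (λ u → does (adj? v u)) v
  ... | yes vv | _  = irrefl vv
  ... | no  _  | eq with trans (sym eq) ([]=⇒lookup v∈N)
  ...   | ()

  degree<n : ∀ v → degree G v ℕ.< n
  degree<n v = subst (degree G v ℕ.<_) (Sub.∣⊤∣≡n n)
    (Sub.p⊂q⇒∣p∣<∣q∣ ((λ _ → Sub.∈⊤) , v , Sub.∈⊤ , v∉neighbours v))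

  singletons : IsGeneralizedPartite G n
  singletons = tabulate ⁅_⁆ , δ , cover , disj
    where
    at : ∀ i → lookup (tabulate ⁅_⁆) i ≡ ⁅ i ⁆
    at = lookup∘tabulate ⁅_⁆

    δ : ∀ i → IsδSet G (lookup (tabulate ⁅_⁆) i)
    δ i v _ = subst (λ k → degree G v ℕ.≤ n ℕ.∸ k)
      (sym (trans (cong ∣_∣ (at i)) (Sub.∣⁅x⁆∣≡1 i)))
      (ℕₚ.<⇒≤pred (degree<n v))

    cover : ∀ v → ∃[ i ] v ∈ lookup (tabulate ⁅_⁆) i
    cover v = v , subst (v ∈_) (sym (at v)) (Sub.x∈⁅x⁆ v)

    disj : ∀ i j → i ≢ j →
           ¬ Nonempty (lookup (tabulate ⁅_⁆) i ∩ lookup (tabulate ⁅_⁆) j)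
    disj i j i≢j (x , x∈) with Sub.x∈p∩q⁻ _ _ x∈
    ... | x∈i , x∈j = i≢j (trans
      (sym (Sub.x∈⁅y⁆⇒x≡y i (subst (x ∈_) (at i) x∈i)))
      (Sub.x∈⁅y⁆⇒x≡y j (subst (x ∈_) (at j) x∈j)))

  φ-spec : ∃ (IsLeast (IsGeneralizedPartite G))
  φ-spec = least isGeneralizedPartite? (n , singletons)

  φ : ℕ
  φ = proj₁ φ-spec

  φ-isLeast : IsLeast (IsGeneralizedPartite G) φ
  φ-isLeast = proj₂ φ-spec

φ-nonZero : ∀ {n} .{{_ : NonZero n}} (G : Graph n) → NonZero (φ G)
φ-nonZero {suc n} G = ℕ.≢-nonZero λ φ≡0 →
  empty (subst (IsGeneralizedPartite G) φ≡0 (proj₁ (φ-isLeast G)))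
  where
  empty : ¬ IsGeneralizedPartite G 0
  empty (_ , _ , cover , _) with cover zero
  ... | () , _

-- Two-sided Dedekind cuts; L and U are the rationals strictly below and
-- strictly above the number.
record ℝ : Set₁ where
  field
    L U         : Pred ℚ 0ℓ
    L-inhabited : ∃ L
    U-inhabited : ∃ U
    L-rounded   : ∀ {p} → L p ⇔ (∃[ r ] p < r × L r)
    U-rounded   : ∀ {p} → U p ⇔ (∃[ r ] r < p × U r)
    disjoint    : ∀ {p} → ¬ (L p × U p)
    located     : ∀ {p r} → p < r → L p ⊎ U r

open ℝ using (L; U)
open Equivalence using (to; from)

infix 4 _≤ℝ_ _<ℝ_ _≃ℝ_

_≤ℝ_ _<ℝ_ _≃ℝ_ : ℝ → ℝ → Set
x ≤ℝ y = ∀ p → L x p → L y p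
x <ℝ y = ∃[ p ] U x p × L y p
x ≃ℝ y = x ≤ℝ y × y ≤ℝ x

L<U : ∀ x {a b} → L x a → U x b → a < b
L<U x {a} {b} La Ub with a <? b
... | yes a<b = a<b
... | no  a≮b with <-cmp a b
...   | tri< a<b _ _ = a<b
...   | tri≈ _ refl _ = contradiction (La , Ub) (ℝ.disjoint x)
...   | tri> _ _ b<a =
        contradiction (from (ℝ.L-rounded x) (a , b<a , La) , Ub) (ℝ.disjoint x)

fromℚ : ℚ → ℝ
fromℚ q = record
  { L           = _< q
  ; U           = q <_
  ; L-inhabited = q - 1ℚ , below q
  ; U-inhabited = q + 1ℚ , above q
  ; L-rounded   = mk⇔ <-dense′ (λ (_ , p<r , r<q) → <-trans p<r r<q)
  ; U-rounded   = mk⇔ (λ q<p → let r , q<r , r<p = <-dense q<p in r , r<p , q<r)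
                      (λ (_ , r<p , q<r) → <-trans q<r r<p)
  ; disjoint    = uncurry <-asym
  ; located     = loc
  }
  where
  above : ∀ q → q < q + 1ℚ
  above q = subst (_< q + 1ℚ) (+-identityʳ q) (+-monoʳ-< q (positive⁻¹ 1ℚ))

  below : ∀ q → q - 1ℚ < q
  below q = subst (q - 1ℚ <_) (+-identityʳ q) (+-monoʳ-< q (negative⁻¹ (- 1ℚ)))

  <-dense′ : ∀ {p} → p < q → ∃[ r ] p < r × r < q
  <-dense′ p<q = let r , p<r , r<q = <-dense p<q in r , p<r , r<q

  loc : ∀ {p r} → p < r → p < q ⊎ q < r
  loc {p} p<r with p <? q
  ... | yes p<q = inj₁ p<q
  ... | no  p≮q = inj₂ (≤-<-trans (≮⇒≥ p≮q) p<r)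

fromℕ : ℕ → ℝ
fromℕ n = fromℚ (ℤ.+ n / 1)

infixl 6 _-ℝ_

_-ℝ_ : ℚ → ℝ → ℝ
q -ℝ x = record
  { L           = λ p → U x (q - p)
  ; U           = λ p → L x (q - p)
  ; L-inhabited = let b , Ub = ℝ.U-inhabited x in q - b , subst (U x) (inv b) Ub
  ; U-inhabited = let a , La = ℝ.L-inhabited x in q - a , subst (L x) (inv a) La
  ; L-rounded   = mk⇔
      (λ Up → let r , r<p , Ur = to (ℝ.U-rounded x) Up in
        q - r , subst (_< q - r) (sym (inv _)) (flip r<p) , subst (U x) (inv r) Ur)
      (λ (r , p<r , Ur) → from (ℝ.U-rounded x) (q - r , flip p<r , Ur))
  ; U-rounded   = mk⇔
      (λ Lp → let r , p<r , Lr = to (ℝ.L-rounded x) Lp in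
        q - r , subst (q - r <_) (sym (inv _)) (flip p<r) , subst (L x) (inv r) Lr)
      (λ (r , r<p , Lr) → from (ℝ.L-rounded x) (q - r , flip r<p , Lr))
  ; disjoint    = λ (Up , Lp) → ℝ.disjoint x (Lp , Up)
  ; located     = λ p<r → swap (ℝ.located x (flip p<r))
  }
  where
  inv : ∀ a → a ≡ q - (q - a)
  inv a = solve 2 (λ q a → a := q :- (q :- a)) refl q a

  flip : ∀ {a b} → a < b → q - b < q - a
  flip a<b = +-monoʳ-< q (neg-antimono-< a<b)

  swap : ∀ {A B : Set} → A ⊎ B → B ⊎ A
  swap (inj₁ a) = inj₂ a
  swap (inj₂ b) = inj₁ b

div : ∀ q b → 0ℚ < b → ∃[ r ] r * b ≡ q
div q b 0<b = q * 1/b , trans (*-assoc q 1/b b)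
  (trans (cong (q *_) (*-inverseˡ b {{b≢0}})) (*-identityʳ q))
  where
  b≢0 = pos⇒nonZero b {{ℚ.positive 0<b}}
  1/b = ℚ.1/_ b {{b≢0}}

mul-mono : ∀ {p r b} → 0ℚ < b → p < r → p * b < r * b
mul-mono {b = b} 0<b = *-monoˡ-<-pos b {{ℚ.positive 0<b}}

mul-cancel : ∀ {p r b} → 0ℚ < b → p * b < r * b → p < r
mul-cancel {b = b} 0<b =
  *-cancelʳ-<-nonNeg b {{pos⇒nonNeg b {{ℚ.positive 0<b}}}}

-- p lies below q / x iff p * b < q for some rational b > x, and above q / x
-- iff q < p * a for some positive rational a < x.
quotient : (q : ℚ) .{{_ : Positive q}} (x : ℝ) → fromℚ 0ℚ <ℝ x → ℝ
quotient q x (a₀ , 0<a₀ , La₀) = record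
  { L           = Lo
  ; U           = Up
  ; L-inhabited = 0ℚ , b₀ , Ub₀ , subst (_< q) (sym (*-zeroˡ b₀)) 0<q
  ; U-inhabited =
      let r , ra≡ = div (q + 1ℚ) a₀ 0<a₀ in
      r , a₀ , La₀ , 0<a₀ , subst (q <_) (sym ra≡) q<q+1
  ; L-rounded   = mk⇔ L⇒ (λ (r , p<r , b , Ub , rb<q) →
      b , Ub , <-trans (mul-mono (U>0 Ub) p<r) rb<q)
  ; U-rounded   = mk⇔ U⇒ (λ (r , r<p , a , La , 0<a , q<ra) →
      a , La , 0<a , <-trans q<ra (mul-mono 0<a r<p))
  ; disjoint    = λ {p} → disj {p}
  ; located     = loc
  }
  where
  Lo Up : Pred ℚ 0ℓ
  Lo p = ∃[ b ] U x b × p * b < q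
  Up p = ∃[ a ] L x a × 0ℚ < a × q < p * a

  b₀  = proj₁ (ℝ.U-inhabited x)
  Ub₀ = proj₂ (ℝ.U-inhabited x)

  0<q : 0ℚ < q
  0<q = positive⁻¹ q

  q<q+1 : q < q + 1ℚ
  q<q+1 = subst (_< q + 1ℚ) (+-identityʳ q) (+-monoʳ-< q (positive⁻¹ 1ℚ))

  U>0 : ∀ {b} → U x b → 0ℚ < b
  U>0 Ub = <-trans 0<a₀ (L<U x La₀ Ub)

  L⇒ : ∀ {p} → Lo p → ∃[ r ] p < r × Lo r
  L⇒ {p} (b , Ub , pb<q) with <-dense pb<q
  ... | m , pb<m , m<q with div m b (U>0 Ub)
  ... | r , rb≡m = r
    , mul-cancel (U>0 Ub) (subst (p * b <_) (sym rb≡m) pb<m)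
    , b , Ub , subst (_< q) (sym rb≡m) m<q

  U⇒ : ∀ {p} → Up p → ∃[ r ] r < p × Up r
  U⇒ {p} (a , La , 0<a , q<pa) with <-dense q<pa
  ... | m , q<m , m<pa with div m a 0<a
  ... | r , ra≡m = r
    , mul-cancel 0<a (subst (_< p * a) (sym ra≡m) m<pa)
    , a , La , 0<a , subst (q <_) (sym ra≡m) q<m

  disj : ∀ {p} → ¬ (Lo p × Up p)
  disj {p} ((b , Ub , pb<q) , (a , La , 0<a , q<pa)) =
    <-asym (<-trans pb<q q<pa)
      (subst₂ _<_ (*-comm a p) (*-comm b p) (mul-mono {b = p} 0<p (L<U x La Ub)))
    where
    0<p : 0ℚ < p
    0<p = mul-cancel {b = a} 0<a
      (subst (_< p * a) (sym (*-zeroˡ a)) (<-trans 0<q q<pa))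

  loc : ∀ {p r} → p < r → Lo p ⊎ Up r
  loc {p} {r} p<r with 0ℚ <? p
  ... | no 0≮p = inj₁ (b₀ , Ub₀ , ≤-<-trans
        (subst (p * b₀ ≤_) (*-zeroˡ b₀)
          (*-monoʳ-≤-nonNeg b₀ {{ℚ.nonNegative (<⇒≤ (U>0 Ub₀))}} (≮⇒≥ 0≮p)))
        0<q)
  ... | yes 0<p with div q p 0<p | div q r (<-trans 0<p p<r)
  ... | t , tp≡q | s , sr≡q with <-dense s<t
    where
    0<r = <-trans 0<p p<r
    0<t : 0ℚ < t
    0<t = mul-cancel 0<p (subst₂ _<_ (sym (*-zeroˡ p)) (sym tp≡q) 0<q)
    s<t : s < t
    s<t = mul-cancel 0<r (subst (_< t * r) (trans tp≡q (sym sr≡q))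
      (subst₂ _<_ (*-comm p t) (*-comm r t) (mul-mono 0<t p<r)))
  ... | m , s<m , m<t with ℝ.located x m<t
  ... | inj₂ Ut = inj₁ (below (to (ℝ.U-rounded x) Ut))
    where
    below : (∃[ b ] b < t × U x b) → Lo p
    below (b , b<t , Ub) =
      b , Ub , subst₂ _<_ (*-comm b p) tp≡q (mul-mono 0<p b<t)
  ... | inj₁ Lm = inj₂ (m , Lm , 0<m , subst₂ _<_ sr≡q (*-comm m r) (mul-mono 0<r s<m))
    where
    0<r = <-trans 0<p p<r
    0<m : 0ℚ < m
    0<m = <-trans (mul-cancel 0<r (subst₂ _<_ (sym (*-zeroˡ r)) (sym sr≡q) 0<q)) s<m

-- For e = d / (2p + 1 + d) and d = q - p², (p + e)² < q.
sqrt-lower : ∀ p q → 0ℚ ≤ p → p * p < q → ∃[ r ] p < r × r * r < q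
sqrt-lower p q 0≤p pp<q = p + e , p<p+e , sq
  where
  d c : ℚ
  d = q - p * p
  c = p + p + 1ℚ

  0<d : 0ℚ < d
  0<d = subst (_< d) (+-inverseʳ (p * p)) (+-monoˡ-< (- (p * p)) pp<q)

  0<c : 0ℚ < c
  0<c = <-≤-trans (positive⁻¹ 1ℚ)
    (subst (_≤ c) (+-identityˡ 1ℚ) (+-monoˡ-≤ 1ℚ (+-mono-≤ 0≤p 0≤p)))

  0<c+d : 0ℚ < c + d
  0<c+d = +-mono-< 0<c 0<d

  e = proj₁ (div d (c + d) 0<c+d)

  e-eq : e * (c + d) ≡ d
  e-eq = proj₂ (div d (c + d) 0<c+d)

  0<e : 0ℚ < e
  0<e = mul-cancel 0<c+d (subst₂ _<_ (sym (*-zeroˡ (c + d))) (sym e-eq) 0<d)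

  e<1 : e < 1ℚ
  e<1 = mul-cancel 0<c+d (subst₂ _<_ (trans (+-identityˡ d) (sym e-eq))
    (sym (*-identityˡ (c + d))) (+-monoˡ-< d 0<c))

  p<p+e : p < p + e
  p<p+e = subst (_< p + e) (+-identityʳ p) (+-monoʳ-< p 0<e)

  0<1-e+d : 0ℚ < (1ℚ - e) + d
  0<1-e+d = +-mono-< (subst (_< 1ℚ - e) (+-inverseʳ e) (+-monoˡ-< (- e) e<1)) 0<d

  gap : p * p + e * (c + d) ≡ ((1ℚ - e) + d) * e + (p + e) * (p + e)
  gap = solve 3 (λ p e d →
    p :* p :+ e :* (p :+ p :+ con 1ℚ :+ d)
      := (con 1ℚ :- e :+ d) :* e :+ (p :+ e) :* (p :+ e)) refl p e d

  total : p * p + e * (c + d) ≡ q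
  total = trans (cong (p * p +_) e-eq)
    (solve 2 (λ p q → p :* p :+ (q :- p :* p) := q) refl p q)

  sq : (p + e) * (p + e) < q
  sq = subst₂ _<_ (+-identityˡ _) (trans (sym gap) total)
    (+-monoˡ-< ((p + e) * (p + e))
      (subst (_< ((1ℚ - e) + d) * e) (*-zeroˡ e) (mul-mono 0<e 0<1-e+d)))

-- For e = (p² - q) / 2p, (p - e)² > q.
sqrt-upper : ∀ p q → 0ℚ ≤ q → 0ℚ < p → q < p * p →
             ∃[ r ] r < p × 0ℚ < r × q < r * r
sqrt-upper p q 0≤q 0<p q<pp = p - e , p-e<p , 0<p-e , sq
  where
  d : ℚ
  d = p * p - q

  0<d : 0ℚ < d
  0<d = subst (_< d) (+-inverseʳ q) (+-monoˡ-< (- q) q<pp)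

  0<2p : 0ℚ < p + p
  0<2p = +-mono-< 0<p 0<p

  e = proj₁ (div d (p + p) 0<2p)

  e-eq : e * (p + p) ≡ d
  e-eq = proj₂ (div d (p + p) 0<2p)

  0<e : 0ℚ < e
  0<e = mul-cancel 0<2p (subst₂ _<_ (sym (*-zeroˡ (p + p))) (sym e-eq) 0<d)

  p-e<p : p - e < p
  p-e<p = subst (p - e <_) (+-identityʳ p) (+-monoʳ-< p (neg-antimono-< 0<e))

  0<pp+q : 0ℚ < p * p + q
  0<pp+q = +-mono-<-≤ (≤-<-trans 0≤q q<pp) 0≤q

  0<p-e : 0ℚ < p - e
  0<p-e = mul-cancel 0<2p (subst₂ _<_ (sym (*-zeroˡ (p + p))) eq 0<pp+q)
    where
    eq : p * p + q ≡ (p - e) * (p + p)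
    eq = sym (trans
      (solve 2 (λ p e → (p :- e) :* (p :+ p)
        := p :* p :+ p :* p :- e :* (p :+ p)) refl p e)
      (trans (cong (λ z → p * p + p * p - z) e-eq)
        (solve 2 (λ p q → p :* p :+ p :* p :- (p :* p :- q) := p :* p :+ q)
          refl p q)))

  sq : q < (p - e) * (p - e)
  sq = subst₂ _<_ (+-identityˡ q) (sym eq)
    (+-monoˡ-< q (subst (_< e * e) (*-zeroˡ e) (mul-mono 0<e 0<e)))
    where
    eq : (p - e) * (p - e) ≡ e * e + q
    eq = trans
      (solve 2 (λ p e → (p :- e) :* (p :- e)
        := e :* e :+ (p :* p :- e :* (p :+ p))) refl p e)
      (cong (e * e +_) (trans (cong (λ z → p * p - z) e-eq)
        (solve 2 (λ p q → p :* p :- (p :* p :- q) := q) refl p q)))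

√ : (q : ℚ) .{{_ : NonNegative q}} → ℝ
√ q = record
  { L           = Lo
  ; U           = Up
  ; L-inhabited = - 1ℚ , inj₁ (negative⁻¹ (- 1ℚ))
  ; U-inhabited = q + 1ℚ , 0<q+1 , q<sq
  ; L-rounded   = mk⇔ L⇒ L⇐
  ; U-rounded   = mk⇔
      (λ (0<p , q<pp) → sqrt-upper _ q 0≤q 0<p q<pp)
      (λ (r , r<p , 0<r , q<rr) → <-trans 0<r r<p , <-trans q<rr (sq-mono (<⇒≤ 0<r) r<p))
  ; disjoint    = λ {p} → disj {p}
  ; located     = loc
  }
  where
  Lo Up : Pred ℚ 0ℓ
  Lo p = p < 0ℚ ⊎ p * p < q
  Up p = 0ℚ < p × q < p * p

  0≤q : 0ℚ ≤ q
  0≤q = nonNegative⁻¹ q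

  0<q+1 : 0ℚ < q + 1ℚ
  0<q+1 = +-mono-≤-< 0≤q (positive⁻¹ 1ℚ)

  q<sq : q < (q + 1ℚ) * (q + 1ℚ)
  q<sq = subst₂ _<_ (+-identityʳ q)
    (solve 1 (λ q → q :+ (q :* q :+ (q :+ con 1ℚ))
      := (q :+ con 1ℚ) :* (q :+ con 1ℚ)) refl q)
    (+-monoʳ-< q (+-mono-≤-< 0≤qq 0<q+1))
    where
    0≤qq : 0ℚ ≤ q * q
    0≤qq = nonNegative⁻¹ (q * q) {{nonNeg*nonNeg⇒nonNeg q q}}

  sq-mono : ∀ {p r} → 0ℚ ≤ p → p < r → p * p < r * r
  sq-mono {p} {r} 0≤p p<r = ≤-<-trans
    (*-monoˡ-≤-nonNeg p {{ℚ.nonNegative 0≤p}} (<⇒≤ p<r))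
    (mul-mono (≤-<-trans 0≤p p<r) p<r)

  L⇒ : ∀ {p} → Lo p → ∃[ r ] p < r × Lo r
  L⇒ {p} Lp with p <? 0ℚ
  L⇒ {p} Lp | yes p<0 = let r , p<r , r<0 = <-dense p<0 in r , p<r , inj₁ r<0
  L⇒ {p} (inj₁ p<0)  | no p≮0 = contradiction p<0 p≮0
  L⇒ {p} (inj₂ pp<q) | no p≮0 =
    let r , p<r , rr<q = sqrt-lower p q (≮⇒≥ p≮0) pp<q in r , p<r , inj₂ rr<q

  L⇐ : ∀ {p} → (∃[ r ] p < r × Lo r) → Lo p
  L⇐ {p} (r , p<r , Lr) with p <? 0ℚ
  L⇐ {p} (r , p<r , Lr)        | yes p<0 = inj₁ p<0
  L⇐ {p} (r , p<r , inj₁ r<0)  | no p≮0  = contradiction (<-trans p<r r<0) p≮0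
  L⇐ {p} (r , p<r , inj₂ rr<q) | no p≮0  = inj₂ (<-trans (sq-mono (≮⇒≥ p≮0) p<r) rr<q)

  disj : ∀ {p} → ¬ (Lo p × Up p)
  disj (inj₁ p<0  , 0<p , _)    = <-asym p<0 0<p
  disj (inj₂ pp<q , _ , q<pp) = <-asym pp<q q<pp

  loc : ∀ {p r} → p < r → Lo p ⊎ Up r
  loc {p} {r} p<r with p <? 0ℚ | p * p <? q
  ... | yes p<0 | _        = inj₁ (inj₁ p<0)
  ... | no  _   | yes pp<q = inj₁ (inj₂ pp<q)
  ... | no  p≮0 | no pp≮q  = inj₂
    ( ≤-<-trans (≮⇒≥ p≮0) p<r
    , ≤-<-trans (≮⇒≥ pp≮q) (sq-mono (≮⇒≥ p≮0) p<r) )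

degreeSquareSum : ∀ {n} → Graph n → ℕ
degreeSquareSum G = Vec.sum (tabulate λ v → degree G v ℕ.^ 2)

meanSquareDegree : ∀ {n} .{{_ : NonZero n}} → Graph n → ℚ
meanSquareDegree {n} G = ℤ.+ degreeSquareSum G / n

quadraticMeanDegree : ∀ {n} .{{_ : NonZero n}} → Graph n → ℝ
quadraticMeanDegree {n} G = √ (meanSquareDegree G) {{normalize-nonNeg (degreeSquareSum G) n}}

sum-tabulate-< : ∀ {n} .{{_ : NonZero n}} (f : Fin n → ℕ) m →
                 (∀ i → f i ℕ.< m) → Vec.sum (tabulate f) ℕ.< n ℕ.* m
sum-tabulate-< {suc n} f m f<m = ℕₚ.+-mono-<-≤ (f<m zero) (bound n (f ∘ suc) (f<m ∘ suc))
  where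
  bound : ∀ k (g : Fin k → ℕ) → (∀ i → g i ℕ.< m) → Vec.sum (tabulate g) ℕ.≤ k ℕ.* m
  bound zero    g g<m = ℕ.z≤n
  bound (suc k) g g<m = ℕₚ.+-mono-≤ (ℕₚ.<⇒≤ (g<m zero)) (bound k (g ∘ suc) (g<m ∘ suc))

/-<-square : ∀ s n .{{_ : NonZero n}} → s ℕ.< n ℕ.* (n ℕ.^ 2) →
             ℤ.+ s / n < (ℤ.+ n / 1) * (ℤ.+ n / 1)
/-<-square s n@(suc k) s<nnn = toℚᵘ-cancel-< (ℚᵘₚ.<-respˡ-≃
  (ℚᵘₚ.≃-sym (toℚᵘ-fromℚᵘ (ℚᵘ.mkℚᵘ (ℤ.+ s) k)))
  (ℚᵘₚ.<-respʳ-≃ (ℚᵘₚ.≃-sym (ℚᵘₚ.≃-trans (toℚᵘ-homo-* n/1 n/1) (ℚᵘₚ.*-cong eq eq)))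
    (ℚᵘ.*<* (subst₂ ℤ._<_ (sym (ℤₚ.*-identityʳ (ℤ.+ s))) cube (ℤ.+<+ s<nnn)))))
  where
  n/1 = ℤ.+ n / 1
  eq : ℚ.toℚᵘ n/1 ℚᵘ.≃ ℚᵘ.mkℚᵘ (ℤ.+ n) 0
  eq = toℚᵘ-fromℚᵘ (ℚᵘ.mkℚᵘ (ℤ.+ n) 0)
  cube : ℤ.+ (n ℕ.* (n ℕ.^ 2)) ≡ (ℤ.+ n ℤ.* ℤ.+ n) ℤ.* ℤ.+ n
  cube = trans (cong ℤ.+_ (trans (cong (λ z → n ℕ.* (n ℕ.* z)) (ℕₚ.*-identityʳ n))
                                 (ℕₚ.*-comm n (n ℕ.* n))))
    (trans (ℤₚ.pos-* (n ℕ.* n) n) (cong (ℤ._* ℤ.+ n) (ℤₚ.pos-* n n)))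

n-qmd>0 : ∀ {n} .{{_ : NonZero n}} (G : Graph n) →
        fromℚ 0ℚ <ℝ (ℤ.+ n / 1) -ℝ quadraticMeanDegree G
n-qmd>0 {n} G = pos (to (ℝ.U-rounded (quadraticMeanDegree G)) (positive⁻¹ N {{normalize-pos n 1}} ,
    /-<-square (degreeSquareSum G) n
      (sum-tabulate-< (λ v → degree G v ℕ.^ 2) (n ℕ.^ 2)
        (λ v → ℕₚ.^-monoˡ-< 2 (degree<n G v)))))
  where
  N = ℤ.+ n / 1
  pos : (∃[ r ] r < N × U (quadraticMeanDegree G) r) → fromℚ 0ℚ <ℝ N -ℝ quadraticMeanDegree G
  pos (r , r<N , Ur) = N - r
    , subst (_< N - r) (+-inverseʳ r) (+-monoˡ-< (- r) r<N)
    , subst (U (quadraticMeanDegree G)) (solve 2 (λ n r → r := n :- (n :- r)) refl N r) Ur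

-- The denominator is positive because every degree is less than n.
degreeBound : ∀ {n} .{{_ : NonZero n}} → Graph n → ℝ
degreeBound {n} G =
  quotient (ℤ.+ n / 1) {{normalize-pos n 1}} ((ℤ.+ n / 1) -ℝ quadraticMeanDegree G) (n-qmd>0 G)

{-# OPTIONS --safe #-}

-- Let the r parts have sizes sᵢ, summing to n. Every vertex of the i-th part has
-- degree at most n - sᵢ, so ∑ d(v)² ≤ ∑ sᵢ (n - sᵢ)². On [0 , n] and for r ≥ 2 the
-- cubic s (n - s)² lies below its tangent at s = n / r, and summing the tangents
-- gives ∑ d(v)² ≤ n (n - n / r)². Equality forces every sᵢ to be n / r or the second
-- contact point 2 n (r - 1) / r ≥ n / r; as the sizes average to n / r, they are all
-- n / r, and every degree is n - n / r. The comparison of n / (n - √ q) with r is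
-- that of q with (n - n / r)².
module Submission where

open import Defs
open import Data.Fin.Base using (Fin; zero; suc)
import Data.Fin.Properties as Fin
open import Data.Fin.Subset using (Subset; _∈_; _∩_; ∣_∣; Nonempty)
import Data.Fin.Subset.Properties as Sub
import Data.Integer.Base as ℤ
import Data.Integer.Properties as ℤₚ
import Data.Nat.Base as ℕ
import Data.Nat.DivMod as ℕₚ
import Data.Nat.Properties as ℕₚ
open import Data.Nat.Base using (ℕ; zero; suc; NonZero)
open import Data.Product using (∃-syntax; _×_; _,_; proj₁; proj₂)
open import Data.Sum.Base using (_⊎_; inj₁; inj₂; fromInj₂)
open import Function.Base using (_∘_)
open import Function.Bundles using (_⇔_; mk⇔; module Equivalence)
open import Relation.Binary.PropositionalEquality
open import Relation.Nullary using (¬_; yes; no; contradiction)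

module DegreeSquares where

  open import Algebra.Properties.AbelianGroup ℤₚ.+-0-abelianGroup using (∙-cancelˡ)
  open import Algebra.Properties.CommutativeSemigroup ℕₚ.*-commutativeSemigroup
    using (xy∙z≈xz∙y)
  open import Algebra.Properties.Semiring.Sum ℤₚ.+-*-semiring
    using (sum; sum-cong-≗; ∑-distrib-+; ∑-comm; *-distribˡ-sum; *-distribʳ-sum)
  open import Data.Bool.Base using (Bool; true; false; if_then_else_)
  open import Data.Integer.Base
    using (ℤ; +_; -[1+_]; 0ℤ; 1ℤ; _+_; _*_; _-_; -_; _≤_; +≤+; nonNegative)
  open import Data.Integer.Properties
  open import Data.Integer.Solver using (module +-*-Solver)
  open import Data.Vec.Base as Vec using (Vec; []; _∷_; lookup; tabulate)
  open import Data.Vec.Properties using (lookup⇒[]=; []=⇒lookup)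
  open import Relation.Binary.Definitions using (tri<; tri≈; tri>)
  open +-*-Solver using (solve; _:+_; _:*_; _:=_; _:-_; con)

  -- Signs and finite sums of integers.

  +-nonNeg : ∀ {i j} → 0ℤ ≤ i → 0ℤ ≤ j → 0ℤ ≤ i + j
  +-nonNeg {i} {j} = +-mono-≤ {0ℤ} {i} {0ℤ} {j}

  *-nonNeg : ∀ {i j} → 0ℤ ≤ i → 0ℤ ≤ j → 0ℤ ≤ i * j
  *-nonNeg {i} {j} 0≤i 0≤j =
    subst (_≤ i * j) (*-zeroʳ i) (*-monoˡ-≤-nonNeg i {{nonNegative 0≤i}} {0ℤ} {j} 0≤j)

  square-nonNeg : ∀ i → 0ℤ ≤ i * i
  square-nonNeg (+ n)    = *-nonNeg {+ n} {+ n} (+≤+ ℕ.z≤n) (+≤+ ℕ.z≤n)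
  square-nonNeg -[1+ n ] = +≤+ ℕ.z≤n

  +-nonNeg-≡0 : ∀ {i j} → 0ℤ ≤ i → 0ℤ ≤ j → i + j ≡ 0ℤ → i ≡ 0ℤ × j ≡ 0ℤ
  +-nonNeg-≡0 {i} {j} 0≤i 0≤j i+j≡0 =
    ≤-antisym (subst₂ _≤_ (+-identityʳ i) i+j≡0 (+-monoʳ-≤ i 0≤j)) 0≤i ,
    ≤-antisym (subst₂ _≤_ (+-identityˡ j) i+j≡0 (+-monoˡ-≤ j 0≤i)) 0≤j

  square≡0 : ∀ i → i * i ≡ 0ℤ → i ≡ 0ℤ
  square≡0 i ii≡0 with i*j≡0⇒i≡0∨j≡0 i {i} ii≡0
  ... | inj₁ i≡0 = i≡0
  ... | inj₂ i≡0 = i≡0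

  sum-nonNeg : ∀ {n} (f : Fin n → ℤ) → (∀ i → 0ℤ ≤ f i) → 0ℤ ≤ sum f
  sum-nonNeg {zero}  f 0≤f = ≤-refl
  sum-nonNeg {suc n} f 0≤f = +-nonNeg {f zero} {sum (f ∘ suc)}
    (0≤f zero) (sum-nonNeg (f ∘ suc) (0≤f ∘ suc))

  sum-nonNeg-≡0 : ∀ {n} (f : Fin n → ℤ) → (∀ i → 0ℤ ≤ f i) → sum f ≡ 0ℤ →
                  ∀ i → f i ≡ 0ℤ
  sum-nonNeg-≡0 {suc n} f 0≤f Σf≡0 = λ where
      zero    → proj₁ split
      (suc i) → sum-nonNeg-≡0 (f ∘ suc) (0≤f ∘ suc) (proj₂ split) i
    where
    split = +-nonNeg-≡0 {f zero} {sum (f ∘ suc)} (0≤f zero)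
      (sum-nonNeg (f ∘ suc) (0≤f ∘ suc)) Σf≡0

  sum-const : ∀ n c → sum {n} (λ _ → c) ≡ + n * c
  sum-const zero    c = sym (*-zeroˡ c)
  sum-const (suc n) c = trans (cong (λ z → c + z) (sum-const n c)) (sym (suc-* (+ n) c))

  pos-sum : ∀ {n} (f : Fin n → ℕ) → + Vec.sum (tabulate f) ≡ sum (+_ ∘ f)
  pos-sum {zero}  f = refl
  pos-sum {suc n} f = trans (pos-+ (f zero) _) (cong (λ z → + f zero + z) (pos-sum (f ∘ suc)))

  𝟙 : Bool → ℤ
  𝟙 b = if b then 1ℤ else 0ℤ

  sum-𝟙-lookup : ∀ {n} (p : Subset n) → sum (𝟙 ∘ lookup p) ≡ + ∣ p ∣
  sum-𝟙-lookup []          = refl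
  sum-𝟙-lookup (true  ∷ p) = trans (cong (λ z → 1ℤ + z) (sum-𝟙-lookup p)) (sym (pos-+ 1 ∣ p ∣))
  sum-𝟙-lookup (false ∷ p) = trans (cong (λ z → 0ℤ + z) (sum-𝟙-lookup p)) (+-identityˡ _)

  -- Allows `g (part v)` to be expanded into a sum over all parts: of the indicators that `v` lies
  -- in a part, exactly one is nonzero.
  sum-𝟙-* : ∀ {n} (b : Fin n → Bool) (g : Fin n → ℤ) c → b c ≡ true →
            (∀ i → i ≢ c → b i ≡ false) → sum (λ i → 𝟙 (b i) * g i) ≡ g c
  sum-𝟙-* {suc n} b g zero bc≡true others = trans
    (cong₂ _+_ (trans (cong (λ b → 𝟙 b * g zero) bc≡true) (*-identityˡ (g zero)))
      (trans (sum-cong-≗ (λ i → cong (λ b → 𝟙 b * g (suc i)) (others (suc i) λ ())))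
        (trans (sum-const n 0ℤ) (*-zeroʳ (+ n)))))
    (+-identityʳ (g zero))
  sum-𝟙-* b g (suc c) bc≡true others = trans
    (cong₂ _+_ (trans (cong (λ b → 𝟙 b * g zero) (others zero λ ())) (*-zeroˡ (g zero)))
      (sum-𝟙-* (b ∘ suc) (g ∘ suc) c bc≡true
        (λ i i≢c → others (suc i) (i≢c ∘ Fin.suc-injective))))
    (+-identityˡ (g (suc c)))

  i+[j-i]≡j : ∀ i j → i + (j - i) ≡ j
  i+[j-i]≡j = solve 2 (λ i j → i :+ (j :- i) := j) refl

  square-injective : ∀ {m n} → m ℕ.* m ≡ n ℕ.* n → m ≡ n
  square-injective {m} {n} eq with ℕₚ.<-cmp m n
  ... | tri< m<n _ _ = contradiction eq (ℕₚ.<⇒≢ (ℕₚ.*-mono-< m<n m<n))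
  ... | tri≈ _ m≡n _ = m≡n
  ... | tri> _ _ n<m = contradiction (sym eq) (ℕₚ.<⇒≢ (ℕₚ.*-mono-< n<m n<m))

  pos-∸ : ∀ {m n} → m ℕ.≤ n → + n - + m ≡ + (n ℕ.∸ m)
  pos-∸ {m} {n} m≤n = trans (m-n≡m⊖n n m) (≤-⊖ m≤n)

  -- Regrouping vertex sums by the parts of a partition.

  module _ {n r} (V : Vec (Subset n) r)
           (cover : ∀ v → ∃[ i ] v ∈ lookup V i)
           (disj : ∀ i j → i ≢ j → ¬ Nonempty (lookup V i ∩ lookup V j))
           where

    part : Fin n → Fin r
    part = proj₁ ∘ cover

    ∉-other : ∀ v i → i ≢ part v → lookup (lookup V i) v ≡ false
    ∉-other v i i≢ with lookup (lookup V i) v in eq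
    ... | false = refl
    ... | true  = contradiction
      (v , Sub.x∈p∩q⁺ (lookup⇒[]= v (lookup V i) eq , proj₂ (cover v)))
      (disj i (part v) i≢)

    -- Double counting: `g (part v)` is expanded with the membership indicators, the two sums are
    -- exchanged, and the indicators of one part add up to its size.
    sum-over-parts : ∀ g → sum (g ∘ part) ≡ sum (λ i → + ∣ lookup V i ∣ * g i)
    sum-over-parts g = begin
      sum (g ∘ part)
        ≡⟨ sum-cong-≗ (λ v → sum-𝟙-* (λ i → lookup (lookup V i) v) g (part v)
             ([]=⇒lookup (proj₂ (cover v))) (∉-other v)) ⟨
      sum (λ v → sum λ i → 𝟙 (lookup (lookup V i) v) * g i)
        ≡⟨ ∑-comm (λ v i → 𝟙 (lookup (lookup V i) v) * g i) ⟩
      sum (λ i → sum λ v → 𝟙 (lookup (lookup V i) v) * g i)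
        ≡⟨ sum-cong-≗ (λ i → trans
             (sym (*-distribʳ-sum (g i) (λ v → 𝟙 (lookup (lookup V i) v))))
             (cong (_* g i) (sum-𝟙-lookup (lookup V i)))) ⟩
      sum (λ i → + ∣ lookup V i ∣ * g i) ∎
      where open ≡-Reasoning

    sum-part-sizes : sum (λ i → + ∣ lookup V i ∣) ≡ + n
    sum-part-sizes = trans
      (sum-cong-≗ (λ i → sym (*-identityʳ (+ ∣ lookup V i ∣))))
      (trans (sym (sum-over-parts (λ _ → 1ℤ)))
        (trans (sum-const n 1ℤ) (*-identityʳ (+ n))))

  -- The tangent-line bound for the cubic `s (N - s)²`.

  -- The first-order expansion of s (N - s)² at s = N / R, scaled by R³.
  tangent-identity : ∀ R N s →
    R * R * R * (s * ((N - s) * (N - s)))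
      + (R * s - N) * (R * s - N) * (+ 2 * (N * (R - 1ℤ)) - R * s)
    ≡ N * (N * (R - 1ℤ)) * (N * (R - 1ℤ)) + N * N * (R - 1ℤ) * (R - + 3) * (R * s - N)
  tangent-identity = solve 3 (λ R N s →
    R :* R :* R :* (s :* ((N :- s) :* (N :- s)))
      :+ (R :* s :- N) :* (R :* s :- N) :* (con (+ 2) :* (N :* (R :- con 1ℤ)) :- R :* s)
    := N :* (N :* (R :- con 1ℤ)) :* (N :* (R :- con 1ℤ))
      :+ N :* N :* (R :- con 1ℤ) :* (R :- con (+ 3)) :* (R :* s :- N)) refl

  -- R is only propositionally + suc r, since products of + suc r unfold during
  -- conversion checking.
  module _ {r} (R N : ℤ) (R≡ : R ≡ + suc r) (s : Fin (suc r) → ℤ)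
           (0≤N : 0ℤ ≤ N) (s≤N : ∀ i → s i ≤ N) (Σs≡N : sum s ≡ N) where

    partSlack : Fin (suc r) → ℤ
    partSlack i = (R * s i - N) * (R * s i - N) * (+ 2 * (N * (R - 1ℤ)) - R * s i)

    -- With a single part the last factor of partSlack is negative, but then the
    -- squared one vanishes.
    balanced-or-bounded : ∀ i → R * s i ≡ N ⊎
      (R * s i ≤ + 2 * (N * (R - 1ℤ)) × N ≤ + 2 * (N * (R - 1ℤ)))
    -- The claim is moved to the literal `+ suc r`, so that matching on `r` computes `R - 1ℤ`.
    balanced-or-bounded i = subst
      (λ R → R * s i ≡ N ⊎ (R * s i ≤ + 2 * (N * (R - 1ℤ)) × N ≤ + 2 * (N * (R - 1ℤ))))
      (sym R≡) (go r s s≤N Σs≡N i)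
      where
      go : ∀ r (s : Fin (suc r) → ℤ) → (∀ i → s i ≤ N) → sum s ≡ N → ∀ i →
           + suc r * s i ≡ N ⊎ (+ suc r * s i ≤ + 2 * (N * (+ suc r - 1ℤ))
                                × N ≤ + 2 * (N * (+ suc r - 1ℤ)))
      go zero s s≤N Σs≡N zero =
        inj₁ (trans (*-identityˡ (s zero)) (trans (sym (+-identityʳ (s zero))) Σs≡N))
      -- With at least two parts, `R ≤ 2 (R - 1)` and `1 ≤ 2 (R - 1)`; here `K` is `R - 1`.
      go (suc k) s s≤N Σs≡N i = inj₂
        ( ≤-trans {+ suc (suc k) * s i} {+ suc (suc k) * N}
            (*-monoˡ-≤-nonNeg (+ suc (suc k)) {s i} {N} (s≤N i))
            (scale {+ suc (suc k)} R≤2K)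
        , subst (_≤ + 2 * (N * K)) (*-identityˡ N) (scale {1ℤ} 1≤2K) )
        where
        K = + suc k
        scale : ∀ {i} → i ≤ + 2 * K → i * N ≤ + 2 * (N * K)
        scale {i} i≤ = subst (i * N ≤_)
          (trans (*-assoc (+ 2) K N) (cong (+ 2 *_) (*-comm K N)))
          (*-monoʳ-≤-nonNeg N {{nonNegative 0≤N}} {i} {+ 2 * K} i≤)
        1≤2K : 1ℤ ≤ + 2 * K
        1≤2K = +≤+ (ℕ.s≤s ℕ.z≤n)
        R≤2K : + suc (suc k) ≤ + 2 * K
        R≤2K = +≤+ (ℕ.s≤s (subst (suc k ℕ.≤_) (sym (ℕₚ.+-suc k (k ℕ.+ 0))) (ℕ.s≤s (ℕₚ.m≤m+n k (k ℕ.+ 0)))))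

    partSlack-nonNeg : ∀ i → 0ℤ ≤ partSlack i
    partSlack-nonNeg i with balanced-or-bounded i
    ... | inj₁ eq = ≤-reflexive (sym (cong
      (λ z → z * z * (+ 2 * (N * (R - 1ℤ)) - R * s i)) (i≡j⇒i-j≡0 {R * s i} {N} eq)))
    ... | inj₂ (≤2NK , _) = *-nonNeg {(R * s i - N) * (R * s i - N)}
      {+ 2 * (N * (R - 1ℤ)) - R * s i} (square-nonNeg (R * s i - N))
      (i≤j⇒0≤j-i {R * s i} {+ 2 * (N * (R - 1ℤ))} ≤2NK)

    sum-const-R : ∀ c → sum {suc r} (λ _ → c) ≡ R * c
    sum-const-R c = trans (sum-const (suc r) c) (cong (_* c) (sym R≡))

    -- The sizes average to `N / R`, so the linear terms of the tangents cancel in the sum.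
    sum-balance : sum (λ i → R * s i - N) ≡ 0ℤ
    sum-balance = begin
      sum (λ i → R * s i - N)             ≡⟨ ∑-distrib-+ (λ i → R * s i) (λ _ → - N) ⟩
      sum (λ i → R * s i) + sum {suc r} (λ _ → - N)
        ≡⟨ cong₂ _+_ (sym (*-distribˡ-sum R s)) (sum-const-R (- N)) ⟩
      R * sum s + R * - N                 ≡⟨ cong (λ z → R * z + R * - N) Σs≡N ⟩
      R * N + R * - N
        ≡⟨ trans (sym (*-distribˡ-+ R N (- N))) (trans (cong (R *_) (+-inverseʳ N)) (*-zeroʳ R)) ⟩
      0ℤ ∎
      where open ≡-Reasoning

    -- Zero slack puts `R * s i` at `N` or at the second contact point `2 N (R - 1)`, which is at
    -- least `N` in the case where it occurs. Thus no deviation `R * s i - N` is negative, and as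
    -- they sum to zero they all vanish.
    partSlack-zero⇒balanced : (∀ i → partSlack i ≡ 0ℤ) → ∀ i → R * s i ≡ N
    partSlack-zero⇒balanced slack≡0 i =
      i-j≡0⇒i≡j (R * s i) N (sum-nonNeg-≡0 (λ i → R * s i - N)
        (λ i → i≤j⇒0≤j-i {N} {R * s i} (N≤Rs i)) sum-balance i)
      where
      N≤Rs : ∀ i → N ≤ R * s i
      N≤Rs i with balanced-or-bounded i
      ... | inj₁ eq = ≤-reflexive (sym eq)
      ... | inj₂ (_ , N≤2NK)
        with i*j≡0⇒i≡0∨j≡0 ((R * s i - N) * (R * s i - N)) {+ 2 * (N * (R - 1ℤ)) - R * s i} (slack≡0 i)
      ... | inj₂ z = subst (N ≤_) (i-j≡0⇒i≡j (+ 2 * (N * (R - 1ℤ))) (R * s i) z) N≤2NK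
      ... | inj₁ z = ≤-reflexive (sym (i-j≡0⇒i≡j (R * s i) N (square≡0 (R * s i - N) z)))

    -- Summing `tangent-identity` over the parts repeats the constant term `R` times and kills the
    -- linear one by `sum-balance`.
    sum-partSlack : R * R * R * sum (λ i → s i * ((N - s i) * (N - s i))) + sum partSlack
                    ≡ R * (N * (N * (R - 1ℤ)) * (N * (R - 1ℤ)))
    sum-partSlack = begin
      R * R * R * sum f + sum partSlack
        ≡⟨ cong (_+ sum partSlack) (*-distribˡ-sum (R * R * R) f) ⟩
      sum (λ i → R * R * R * f i) + sum partSlack
        ≡⟨ ∑-distrib-+ (λ i → R * R * R * f i) partSlack ⟨
      sum (λ i → R * R * R * f i + partSlack i)
        ≡⟨ sum-cong-≗ (λ i → tangent-identity R N (s i)) ⟩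
      sum (λ i → A + B * (R * s i - N))
        ≡⟨ ∑-distrib-+ (λ _ → A) (λ i → B * (R * s i - N)) ⟩
      sum {suc r} (λ _ → A) + sum (λ i → B * (R * s i - N))
        ≡⟨ cong₂ _+_ (sum-const-R A) (sym (*-distribˡ-sum B (λ i → R * s i - N))) ⟩
      R * A + B * sum (λ i → R * s i - N)
        ≡⟨ cong (λ z → R * A + B * z) sum-balance ⟩
      R * A + B * 0ℤ
        ≡⟨ trans (cong (λ z → R * A + z) (*-zeroʳ B)) (+-identityʳ (R * A)) ⟩
      R * A ∎
      where
      open ≡-Reasoning
      f : Fin (suc r) → ℤ
      f i = s i * ((N - s i) * (N - s i))
      -- `A` is the scaled value of the tangent at the contact point and `B` its slope as a function
      -- of `R * s i`.
      A B : ℤ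
      A = N * (N * (R - 1ℤ)) * (N * (R - 1ℤ))
      B = N * N * (R - 1ℤ) * (R - + 3)

  -- Upper bound for the sum of squared degrees, and its equality case.

  degreeSquareSum-as-sum : ∀ {n} (G : Graph n) →
    + degreeSquareSum G ≡ sum (λ v → + degree G v * + degree G v)
  degreeSquareSum-as-sum G = trans (pos-sum (λ v → degree G v ℕ.^ 2))
    (sum-cong-≗ λ v → trans (cong (λ k → + (degree G v ℕ.* k)) (ℕₚ.*-identityʳ (degree G v)))
                            (pos-* (degree G v) (degree G v)))

  module _ {n r} (G : Graph n) (partite : IsGeneralizedPartite G (suc r))
           (R N S : ℤ) (R≡ : R ≡ + suc r) (N≡ : N ≡ + n) (S≡ : S ≡ + degreeSquareSum G) where
    private
      V : Vec (Subset n) (suc r)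
      V = proj₁ partite
      δ = proj₁ (proj₂ partite)
      cover = proj₁ (proj₂ (proj₂ partite))
      disj  = proj₂ (proj₂ (proj₂ partite))
      bound : ℤ
      bound = R * (N * (N * (R - 1ℤ)) * (N * (R - 1ℤ)))
      size : Fin (suc r) → ℕ
      size i = ∣ lookup V i ∣
      s : Fin (suc r) → ℤ
      s i = + size i
      d : Fin n → ℤ
      d v = + degree G v
      c : Fin n → Fin (suc r)
      c = part V cover disj

      0≤N : 0ℤ ≤ N
      0≤N = subst (0ℤ ≤_) (sym N≡) (+≤+ ℕ.z≤n)

      s≤N : ∀ i → s i ≤ N
      s≤N i = subst (s i ≤_) (sym N≡) (+≤+ (Sub.∣p∣≤n (lookup V i)))

      Σs≡N : sum s ≡ N
      Σs≡N = trans (sum-part-sizes V cover disj) (sym N≡)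

      codegree : Fin n → ℕ
      codegree v = n ℕ.∸ size (c v)

      vertexSlack : Fin n → ℤ
      vertexSlack v = (N - s (c v)) * (N - s (c v)) - d v * d v

      vertexSlack≡ : ∀ v → vertexSlack v ≡
        + (codegree v ℕ.* codegree v) - + (degree G v ℕ.* degree G v)
      vertexSlack≡ v = cong₂ _-_
        (trans (cong₂ _*_ eq eq) (sym (pos-* (codegree v) (codegree v))))
        (sym (pos-* (degree G v) (degree G v)))
        where eq = trans (cong (_- s (c v)) N≡) (pos-∸ (Sub.∣p∣≤n (lookup V (c v))))

      -- The δ-set condition for the part of `v`, squared. The truncated difference in it is exact
      -- because a part has at most `n` elements.
      vertexSlack-nonNeg : ∀ v → 0ℤ ≤ vertexSlack v
      vertexSlack-nonNeg v = subst (0ℤ ≤_) (sym (vertexSlack≡ v))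
        (i≤j⇒0≤j-i {+ (degree G v ℕ.* degree G v)} {+ (codegree v ℕ.* codegree v)}
          (+≤+ (ℕₚ.*-mono-≤ d≤ d≤)))
        where d≤ = δ (c v) v (proj₂ (cover v))

      partsSlack slack : ℤ
      partsSlack = sum (partSlack R N R≡ s 0≤N s≤N Σs≡N)
      slack = R * R * R * sum vertexSlack + partsSlack

      -- Adding the vertex slacks to `S` replaces each squared degree by `(N - s)²` for the part of
      -- that vertex. Grouped by parts this is the sum of the cubics, to which `sum-partSlack`
      -- applies.
      total : R * R * R * S + slack ≡ bound
      total = begin
        R * R * R * S + slack
          ≡⟨ trans (sym (+-assoc (R * R * R * S) (R * R * R * sum vertexSlack) partsSlack))
               (cong (_+ partsSlack) (sym (*-distribˡ-+ (R * R * R) S (sum vertexSlack)))) ⟩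
        R * R * R * (S + sum vertexSlack) + partsSlack
          ≡⟨ cong (λ z → R * R * R * z + partsSlack) sum-codegrees ⟩
        R * R * R * sum (λ i → s i * ((N - s i) * (N - s i))) + partsSlack
          ≡⟨ sum-partSlack R N R≡ s 0≤N s≤N Σs≡N ⟩
        bound ∎
        where
        open ≡-Reasoning
        sum-codegrees : S + sum vertexSlack ≡ sum (λ i → s i * ((N - s i) * (N - s i)))
        sum-codegrees = begin
          S + sum vertexSlack
            ≡⟨ cong (_+ sum vertexSlack) (trans S≡ (degreeSquareSum-as-sum G)) ⟩
          sum (λ v → d v * d v) + sum vertexSlack
            ≡⟨ ∑-distrib-+ (λ v → d v * d v) vertexSlack ⟨
          sum (λ v → d v * d v + vertexSlack v)
            ≡⟨ sum-cong-≗ (λ v → i+[j-i]≡j (d v * d v) ((N - s (c v)) * (N - s (c v)))) ⟩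
          sum (λ v → (N - s (c v)) * (N - s (c v)))
            ≡⟨ sum-over-parts V cover disj (λ i → (N - s i) * (N - s i)) ⟩
          sum (λ i → s i * ((N - s i) * (N - s i))) ∎

      0≤RRR : 0ℤ ≤ R * R * R
      0≤RRR = *-nonNeg {R * R} {R} (square-nonNeg R) (subst (0ℤ ≤_) (sym R≡) (+≤+ ℕ.z≤n))

      RRR≢0 : R * R * R ≢ 0ℤ
      RRR≢0 eq with i*j≡0⇒i≡0∨j≡0 (R * R) {R} eq
      ... | inj₁ RR≡0 = contradiction (trans (sym R≡) (square≡0 R RR≡0)) λ ()
      ... | inj₂ R≡0  = contradiction (trans (sym R≡) R≡0) λ ()

      0≤RRRΣ : 0ℤ ≤ R * R * R * sum vertexSlack
      0≤RRRΣ = *-nonNeg {R * R * R} {sum vertexSlack} 0≤RRR (sum-nonNeg vertexSlack vertexSlack-nonNeg)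

      0≤Σ : 0ℤ ≤ partsSlack
      0≤Σ = sum-nonNeg (partSlack R N R≡ s 0≤N s≤N Σs≡N) (partSlack-nonNeg R N R≡ s 0≤N s≤N Σs≡N)

    degreeSquareSum-bound : R * R * R * S ≤ bound
    degreeSquareSum-bound = subst₂ _≤_ (+-identityʳ (R * R * R * S)) total
      (+-monoʳ-≤ (R * R * R * S) {0ℤ} {slack}
        (+-nonNeg {R * R * R * sum vertexSlack} {partsSlack} 0≤RRRΣ 0≤Σ))

    -- Equality makes the total slack zero, hence each of its nonnegative terms. The part slacks
    -- then force all parts to have size `n / suc r`, and the vertex slacks force every degree up to
    -- its δ-set bound.
    degreeSquareSum-max⇒regular : R * R * R * S ≡ bound →
      n ℕ.% suc r ≡ 0 × IsRegular G (n ℕ.* r ℕ./ suc r)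
    degreeSquareSum-max⇒regular eq =
      trans (cong (ℕ._% suc r) (balanced zero)) (ℕₚ.m*n%n≡0 (size zero) (suc r)) , regular
      where
      slack≡0 : slack ≡ 0ℤ
      slack≡0 = ∙-cancelˡ (R * R * R * S) slack 0ℤ
        (trans total (trans (sym eq) (sym (+-identityʳ (R * R * R * S)))))

      both = +-nonNeg-≡0 {R * R * R * sum vertexSlack} {partsSlack} 0≤RRRΣ 0≤Σ slack≡0

      balanced : ∀ i → n ≡ size i ℕ.* suc r
      balanced i = +-injective (trans (sym N≡) (trans
        (sym (partSlack-zero⇒balanced R N R≡ s 0≤N s≤N Σs≡N
          (sum-nonNeg-≡0 (partSlack R N R≡ s 0≤N s≤N Σs≡N)
            (partSlack-nonNeg R N R≡ s 0≤N s≤N Σs≡N) (proj₂ both)) i))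
        (trans (cong (_* s i) R≡) (trans (*-comm (+ suc r) (s i)) (sym (pos-* (size i) (suc r)))))))

      vertexSlack≡0 : ∀ v → vertexSlack v ≡ 0ℤ
      vertexSlack≡0 = sum-nonNeg-≡0 vertexSlack vertexSlack-nonNeg
        (fromInj₂ (λ z → contradiction z RRR≢0)
          (i*j≡0⇒i≡0∨j≡0 (R * R * R) {sum vertexSlack} (proj₁ both)))

      regular : IsRegular G (n ℕ.* r ℕ./ suc r)
      regular v = begin
        degree G v             ≡⟨ square-injective (+-injective (i-j≡0⇒i≡j
                                    (+ (codegree v ℕ.* codegree v))
                                    (+ (degree G v ℕ.* degree G v))
                                    (trans (sym (vertexSlack≡ v)) (vertexSlack≡0 v)))) ⟨
        -- Here `n = k * suc r = k + k * r`, so the difference is `k * r` and the final division is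
        -- exact.
        n ℕ.∸ k                ≡⟨ cong (ℕ._∸ k) (trans (balanced (c v)) (ℕₚ.*-suc k r)) ⟩
        k ℕ.+ k ℕ.* r ℕ.∸ k    ≡⟨ ℕₚ.m+n∸m≡n k (k ℕ.* r) ⟩
        k ℕ.* r                ≡⟨ ℕₚ.m*n/n≡m (k ℕ.* r) (suc r) ⟨
        k ℕ.* r ℕ.* suc r ℕ./ suc r
          ≡⟨ cong (ℕ._/ suc r) (trans (xy∙z≈xz∙y k r (suc r)) (cong (ℕ._* r) (sym (balanced (c v))))) ⟩
        n ℕ.* r ℕ./ suc r ∎
        where
        open ≡-Reasoning
        k = size (c v)

  -- Regular graphs of the extremal degree attain the bound.

  distribute-squares : ∀ R N Q K →
    R * R * R * (N * (Q * K * (Q * K))) ≡ R * (N * (Q * R * K) * (Q * R * K))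
  distribute-squares = solve 4 (λ R N Q K →
    R :* R :* R :* (N :* (Q :* K :* (Q :* K))) := R :* (N :* (Q :* R :* K) :* (Q :* R :* K))) refl

  module _ {n r} (G : Graph n)
           (R N S : ℤ) (R≡ : R ≡ + suc r) (N≡ : N ≡ + n) (S≡ : S ≡ + degreeSquareSum G) where

    regular⇒degreeSquareSum-max : n ℕ.% suc r ≡ 0 → IsRegular G (n ℕ.* r ℕ./ suc r) →
      R * R * R * S ≡ R * (N * (N * (R - 1ℤ)) * (N * (R - 1ℤ)))
    regular⇒degreeSquareSum-max n%≡0 regular = begin
      R * R * R * S                      ≡⟨ cong (λ z → R * R * R * z) S≡NQKQK ⟩
      -- One factor `R` moves next to each `Q`, so that `Q * R` can be replaced by `N`.
      R * R * R * (N * (Q * K * (Q * K))) ≡⟨ distribute-squares R N Q K ⟩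
      R * (N * (Q * R * K) * (Q * R * K)) ≡⟨ cong (λ z → R * (N * (z * K) * (z * K))) QR≡N ⟩
      R * (N * (N * K) * (N * K)) ∎
      where
      open ≡-Reasoning
      q = n ℕ./ suc r
      K Q : ℤ
      K = R - 1ℤ
      Q = + q

      n≡ : n ≡ q ℕ.* suc r
      n≡ = trans (ℕₚ.m≡m%n+[m/n]*n n (suc r)) (cong (ℕ._+ q ℕ.* suc r) n%≡0)

      QR≡N : Q * R ≡ N
      QR≡N = trans (cong (Q *_) R≡) (trans (sym (pos-* q (suc r))) (trans (cong +_ (sym n≡)) (sym N≡)))

      degree≡ : ∀ v → degree G v ≡ q ℕ.* r
      degree≡ v = begin
        degree G v                     ≡⟨ regular v ⟩
        n ℕ.* r ℕ./ suc r              ≡⟨ cong (ℕ._/ suc r) (trans (cong (ℕ._* r) n≡) (xy∙z≈xz∙y q (suc r) r)) ⟩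
        q ℕ.* r ℕ.* suc r ℕ./ suc r    ≡⟨ ℕₚ.m*n/n≡m (q ℕ.* r) (suc r) ⟩
        q ℕ.* r ∎

      d≡ : ∀ v → + degree G v ≡ Q * K
      d≡ v = trans (cong +_ (degree≡ v))
        -- `+ suc r - 1ℤ` computes to `+ r`, so only `R` has to be rewritten.
        (trans (pos-* q r) (cong (λ z → Q * (z - 1ℤ)) (sym R≡)))

      S≡NQKQK : S ≡ N * (Q * K * (Q * K))
      S≡NQKQK = begin
        S                                        ≡⟨ trans S≡ (degreeSquareSum-as-sum G) ⟩
        sum (λ v → + degree G v * + degree G v)  ≡⟨ sum-cong-≗ (λ v → cong (λ z → z * z) (d≡ v)) ⟩
        sum {n} (λ _ → Q * K * (Q * K))          ≡⟨ sum-const n (Q * K * (Q * K)) ⟩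
        + n * (Q * K * (Q * K))                  ≡⟨ cong (_* (Q * K * (Q * K))) (sym N≡) ⟩
        N * (Q * K * (Q * K)) ∎

module CutComparison where

  open DegreeSquares
    using (degreeSquareSum-bound; degreeSquareSum-max⇒regular; regular⇒degreeSquareSum-max)
  open import Data.Rational.Base as ℚ
    using (ℚ; 0ℚ; 1ℚ; _/_; _<_; _≤_; _+_; _-_; _*_; -_; Positive; NonNegative)
  open import Data.Rational.Properties
  open import Data.Rational.Solver using (module +-*-Solver)
  import Data.Rational.Unnormalised.Base as ℚᵘ
  import Data.Rational.Unnormalised.Properties as ℚᵘₚ
  open +-*-Solver using (solve; _:+_; _:*_; _:=_; _:-_; con)

  -- Squares of rationals and the embedding of the integers.

  square-mono-≤ : ∀ {p r} → 0ℚ ≤ p → p ≤ r → p * p ≤ r * r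
  square-mono-≤ {p} {r} 0≤p p≤r = ≤-trans
    (*-monoˡ-≤-nonNeg p {{ℚ.nonNegative 0≤p}} p≤r)
    (*-monoʳ-≤-nonNeg r {{ℚ.nonNegative (≤-trans 0≤p p≤r)}} p≤r)

  ι : ℤ.ℤ → ℚ
  ι i = i / 1

  toℚᵘ-ι : ∀ i → ℚ.toℚᵘ (ι i) ℚᵘ.≃ ℚᵘ.mkℚᵘ i 0
  toℚᵘ-ι i = toℚᵘ-fromℚᵘ (ℚᵘ.mkℚᵘ i 0)

  ι-* : ∀ i j → ι (i ℤ.* j) ≡ ι i * ι j
  ι-* i j = toℚᵘ-injective (ℚᵘₚ.≃-trans (toℚᵘ-ι (i ℤ.* j)) (ℚᵘₚ.≃-sym
    (ℚᵘₚ.≃-trans (toℚᵘ-homo-* (ι i) (ι j)) (ℚᵘₚ.*-cong (toℚᵘ-ι i) (toℚᵘ-ι j)))))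

  ι-+ : ∀ i j → ι (i ℤ.+ j) ≡ ι i + ι j
  ι-+ i j = toℚᵘ-injective (ℚᵘₚ.≃-trans (toℚᵘ-ι (i ℤ.+ j)) (ℚᵘₚ.≃-sym
    (ℚᵘₚ.≃-trans (toℚᵘ-homo-+ (ι i) (ι j)) (ℚᵘₚ.≃-trans (ℚᵘₚ.+-cong (toℚᵘ-ι i) (toℚᵘ-ι j))
      (ℚᵘ.*≡* (cong (ℤ._* ℤ.1ℤ) (cong₂ ℤ._+_ (ℤₚ.*-identityʳ i) (ℤₚ.*-identityʳ j))))))))

  ι-mono-≤ : ∀ {i j} → i ℤ.≤ j → ι i ≤ ι j
  ι-mono-≤ {i} {j} i≤j = toℚᵘ-cancel-≤ (ℚᵘₚ.≤-respˡ-≃ (ℚᵘₚ.≃-sym (toℚᵘ-ι i))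
    (ℚᵘₚ.≤-respʳ-≃ (ℚᵘₚ.≃-sym (toℚᵘ-ι j)) (ℚᵘ.*≤* (ℤₚ.*-monoʳ-≤-nonNeg ℤ.1ℤ i≤j))))

  ι-injective : ∀ {i j} → ι i ≡ ι j → i ≡ j
  ι-injective {i} {j} eq
    with ℚᵘ.*≡* eq′ ← fromℚᵘ-injective {ℚᵘ.mkℚᵘ i 0} {ℚᵘ.mkℚᵘ j 0} eq
    = trans (sym (ℤₚ.*-identityʳ i)) (trans eq′ (ℤₚ.*-identityʳ j))

  /-*-cancel : ∀ i n .{{_ : NonZero n}} → i / n * ι (ℤ.+ n) ≡ ι i
  /-*-cancel i n@(suc k) = toℚᵘ-injective (ℚᵘₚ.≃-trans (toℚᵘ-homo-* (i / n) (ι (ℤ.+ n)))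
    (ℚᵘₚ.≃-trans (ℚᵘₚ.*-cong (toℚᵘ-fromℚᵘ (ℚᵘ.mkℚᵘ i k)) (toℚᵘ-ι (ℤ.+ n)))
    (ℚᵘₚ.≃-trans (ℚᵘ.*≡* (trans (ℤₚ.*-identityʳ (i ℤ.* ℤ.+ n))
        (cong (λ m → i ℤ.* ℤ.+ m) (sym (ℕₚ.*-identityʳ n)))))
      (ℚᵘₚ.≃-sym (toℚᵘ-ι i)))))

  -- Comparison of the cut `N / (N - √ q)` with a rational `R`, where `D = N / R`.

  module _ (q N R D : ℚ) .{{_ : NonNegative q}} .{{_ : Positive N}}
           (DR≡N : D * R ≡ N) (0<R : 0ℚ < R) (D≤N : D ≤ N)
           (N-√q>0 : fromℚ 0ℚ <ℝ N -ℝ √ q) where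
    private
      T : ℚ
      T = N - D

      bound : ℝ
      bound = quotient N (N -ℝ √ q) N-√q>0

      0≤T : 0ℚ ≤ T
      0≤T = subst (_≤ T) (+-inverseʳ D) (+-monoˡ-≤ (- D) D≤N)

      0<D : 0ℚ < D
      0<D = mul-cancel 0<R (subst₂ _<_ (sym (*-zeroˡ R)) (sym DR≡N) (positive⁻¹ N))

      N-[N-p] : ∀ p → N - (N - p) ≡ p
      N-[N-p] = solve 2 (λ N p → N :- (N :- p) := p) refl N

      N-antimono-< : ∀ {a b} → a < b → N - b < N - a
      N-antimono-< a<b = +-monoʳ-< N (neg-antimono-< a<b)

      N-cancel-< : ∀ {a b} → N - b < N - a → a < b
      N-cancel-< {a} {b} lt = subst₂ _<_ (N-[N-p] a) (N-[N-p] b) (N-antimono-< lt)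

    -- A rational `p` below the quotient comes with some `b` above `N - √ q`, so that `N - b` is
    -- below `√ q` and hence below `T`. Then `D < b`, and `p * b < N = D * R < R * b` yields
    -- `p < R`.
    quotient-√-≤ : q ≤ T * T → bound ≤ℝ fromℚ R
    quotient-√-≤ q≤TT p (b , Lb , pb<N) = mul-cancel (<-trans 0<D D<b) (<-trans pb<N
        (subst₂ _<_ DR≡N (*-comm b R) (mul-mono 0<R D<b)))
      where
      L⇒<T : ∀ {x} → ℝ.L (√ q) x → x < T
      L⇒<T (inj₁ x<0) = <-≤-trans x<0 0≤T
      L⇒<T {x} (inj₂ xx<q) with x <? T
      ... | yes x<T = x<T
      ... | no  x≮T = contradiction (<-≤-trans xx<q (≤-trans q≤TT (square-mono-≤ 0≤T (≮⇒≥ x≮T))))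
                                    (<-irrefl refl)

      D<b : D < b
      D<b = N-cancel-< (L⇒<T Lb)

    -- By locatedness, only the case of `R` above the quotient must be excluded. Its witness `a`
    -- exceeds `D`, so `0 < N - a < T`, while `q < (N - a)²` contradicts `T * T ≤ q`.
    quotient-√-≥ : T * T ≤ q → fromℚ R ≤ℝ bound
    quotient-√-≥ TT≤q p p<R with ℝ.located bound p<R
    ... | inj₁ Lp = Lp
    ... | inj₂ (a , (0<N-a , q<sq) , 0<a , N<Ra) = contradiction
      (<-≤-trans q<sq (≤-trans (square-mono-≤ (<⇒≤ 0<N-a) (<⇒≤ (N-antimono-< D<a))) TT≤q))
      (<-irrefl refl)
      where
      D<a : D < a
      D<a = mul-cancel 0<R (subst₂ _<_ (sym DR≡N) (*-comm R a) N<Ra)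

    -- If `q < T * T`, then `T` is above `√ q` and, by roundedness, so is some `t < T`. The witness
    -- `N - t > D` puts `R` above the quotient; roundedness again gives a `p < R` above it, which
    -- the hypothesis places below.
    quotient-√-≥⁻¹ : fromℚ R ≤ℝ bound → T * T ≤ q
    quotient-√-≥⁻¹ R≤bound = ≮⇒≥ λ q<TT →
      -- `T ≤ 0` would give `T = 0` and so `q < 0`.
      let 0<T = ≰⇒> λ T≤0 → <-irrefl refl (≤-<-trans (nonNegative⁻¹ q) (<-≤-trans q<TT
                  (≤-reflexive (cong (λ t → t * t) (≤-antisym T≤0 0≤T)))))
          t , t<T , Ut = Equivalence.to (ℝ.U-rounded (√ q)) (0<T , q<TT)
          D<N-t = subst (_< N - t) (N-[N-p] D) (N-antimono-< t<T)
          N<R[N-t] = subst₂ _<_ DR≡N (*-comm (N - t) R) (mul-mono 0<R D<N-t)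
          p , p<R , Up = Equivalence.to (ℝ.U-rounded bound)
            (N - t , subst (ℝ.U (√ q)) (sym (N-[N-p] t)) Ut , <-trans 0<D D<N-t , N<R[N-t])
      in ℝ.disjoint bound {p} (R≤bound p p<R , Up)

  -- Transfer of the integer bound to the quadratic mean degree.

  module _ {n r} .{{_ : NonZero n}} (G : Graph n) (partite : IsGeneralizedPartite G (suc r)) where
    private
      Rᶻ Nᶻ Sᶻ lhsᶻ rhsᶻ : ℤ.ℤ
      Rᶻ = ℤ.+ suc r
      Nᶻ = ℤ.+ n
      Sᶻ = ℤ.+ degreeSquareSum G
      lhsᶻ = Rᶻ ℤ.* Rᶻ ℤ.* Rᶻ ℤ.* Sᶻ
      rhsᶻ = Rᶻ ℤ.* (Nᶻ ℤ.* (Nᶻ ℤ.* (Rᶻ ℤ.- ℤ.1ℤ)) ℤ.* (Nᶻ ℤ.* (Rᶻ ℤ.- ℤ.1ℤ)))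
      q N R D T C : ℚ
      q = meanSquareDegree G
      N = ι Nᶻ
      R = ι Rᶻ

      0<R : 0ℚ < R
      0<R = positive⁻¹ R {{normalize-pos (suc r) 1}}

      0<N : 0ℚ < N
      0<N = positive⁻¹ N {{normalize-pos n 1}}

      D = proj₁ (div N R 0<R)
      DR≡N = proj₂ (div N R 0<R)
      T = N - D
      -- Multiplication by `C` turns `q` and `T * T` into the two sides of `degreeSquareSum-bound`.
      C = R * R * R * N

      D≤N : D ≤ N
      D≤N = subst₂ _≤_ (*-identityʳ D) DR≡N
        (*-monoˡ-≤-nonNeg D {{ℚ.nonNegative (<⇒≤ 0<D)}} (ι-mono-≤ {ℤ.1ℤ} {Rᶻ} (ℤ.+≤+ (ℕ.s≤s ℕ.z≤n))))
        where
        0<D : 0ℚ < D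
        0<D = mul-cancel 0<R (subst₂ _<_ (sym (*-zeroˡ R)) (sym DR≡N) 0<N)

      instance
        q≥0 : NonNegative q
        q≥0 = normalize-nonNeg (degreeSquareSum G) n
        N>0 : Positive N
        N>0 = normalize-pos n 1
        C>0 : Positive C
        C>0 = ℚ.positive (*-pos (*-pos (*-pos 0<R 0<R) 0<R) 0<N)
          where
          *-pos : ∀ {a b} → 0ℚ < a → 0ℚ < b → 0ℚ < a * b
          *-pos {a} {b} 0<a 0<b = subst (_< a * b) (*-zeroˡ b) (mul-mono 0<b 0<a)

      ι-lhs : C * q ≡ ι lhsᶻ
      ι-lhs = begin
        R * R * R * N * q        ≡⟨ solve 3 (λ a b c → a :* b :* c := a :* (c :* b)) refl (R * R * R) N q ⟩
        R * R * R * (q * N)      ≡⟨ cong (R * R * R *_) (/-*-cancel Sᶻ n) ⟩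
        R * R * R * ι Sᶻ         ≡⟨ cong (_* ι Sᶻ) (trans (ι-* (Rᶻ ℤ.* Rᶻ) Rᶻ) (cong (_* R) (ι-* Rᶻ Rᶻ))) ⟨
        ι (Rᶻ ℤ.* Rᶻ ℤ.* Rᶻ) * ι Sᶻ ≡⟨ ι-* (Rᶻ ℤ.* Rᶻ ℤ.* Rᶻ) Sᶻ ⟨
        ι lhsᶻ ∎
        where open ≡-Reasoning

      ι-rhs : C * (T * T) ≡ ι rhsᶻ
      ι-rhs = begin
        R * R * R * N * (T * T)
          ≡⟨ solve 3 (λ R N D → R :* R :* R :* N :* ((N :- D) :* (N :- D))
               := R :* (N :* (N :* R :- D :* R) :* (N :* R :- D :* R))) refl R N D ⟩
        R * (N * (N * R - D * R) * (N * R - D * R))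
          ≡⟨ cong (λ z → R * (N * z * z)) (trans (cong (λ z → N * R - z) DR≡N)
               (solve 2 (λ N R → N :* R :- N := N :* (R :- con 1ℚ)) refl N R)) ⟩
        R * (N * (N * (R - 1ℚ)) * (N * (R - 1ℚ)))
          ≡⟨ cong (λ z → R * (N * z * z)) ι-M ⟨
        R * (N * ι Mᶻ * ι Mᶻ)
          ≡⟨ cong (R *_) (trans (ι-* (Nᶻ ℤ.* Mᶻ) Mᶻ) (cong (_* ι Mᶻ) (ι-* Nᶻ Mᶻ))) ⟨
        R * ι (Nᶻ ℤ.* Mᶻ ℤ.* Mᶻ)
          ≡⟨ ι-* Rᶻ (Nᶻ ℤ.* Mᶻ ℤ.* Mᶻ) ⟨
        ι rhsᶻ ∎
        where
        open ≡-Reasoning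
        Mᶻ : ℤ.ℤ
        Mᶻ = Nᶻ ℤ.* (Rᶻ ℤ.- ℤ.1ℤ)
        ι-M : ι Mᶻ ≡ N * (R - 1ℚ)
        ι-M = trans (ι-* Nᶻ (Rᶻ ℤ.- ℤ.1ℤ)) (cong (N *_) (ι-+ Rᶻ ℤ.-1ℤ))

      q≤TT : q ≤ T * T
      q≤TT = *-cancelˡ-≤-pos C (subst₂ _≤_ (sym ι-lhs) (sym ι-rhs)
        (ι-mono-≤ (degreeSquareSum-bound G partite Rᶻ Nᶻ Sᶻ refl refl refl)))

    degreeBound-≤ : degreeBound G ≤ℝ fromℕ (suc r)
    degreeBound-≤ = quotient-√-≤ q N R D DR≡N 0<R D≤N (n-qmd>0 G) q≤TT

    -- One half of `≃ℝ` is `degreeBound-≤`. The other amounts to `T * T ≤ q`, hence with `q≤TT` to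
    -- `q ≡ T * T`, which is equality in the integer bound.
    degreeBound-≡⇔regular : fromℕ (suc r) ≃ℝ degreeBound G
      ⇔ (n ℕ.% suc r ≡ 0 × IsRegular G (n ℕ.* r ℕ./ suc r))
    degreeBound-≡⇔regular = mk⇔
      (λ (r≤ , _) → degreeSquareSum-max⇒regular G partite Rᶻ Nᶻ Sᶻ refl refl refl (ι-injective
        (trans (sym ι-lhs) (trans
          (cong (C *_) (≤-antisym q≤TT (quotient-√-≥⁻¹ q N R D DR≡N 0<R D≤N (n-qmd>0 G) r≤)))
          ι-rhs))))
      (λ (n%≡0 , regular) →
        quotient-√-≥ q N R D DR≡N 0<R D≤N (n-qmd>0 G) (*-cancelˡ-≤-pos C (≤-reflexive
          (trans ι-rhs (trans (cong ι (sym
            (regular⇒degreeSquareSum-max G Rᶻ Nᶻ Sᶻ refl refl refl n%≡0 regular))) (sym ι-lhs))))) ,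
        degreeBound-≤)

-- The bound for `φ G`.

open CutComparison using (degreeBound-≤; degreeBound-≡⇔regular)
open import Data.Nat.Base using (_*_; _∸_; _/_; _%_)

-- With `r` a variable in place of `φ G`, matching on it turns `r ∸ 1` into a predecessor.
partite⇒degreeBound : ∀ {n} .{{_ : NonZero n}} (G : Graph n) r .{{_ : NonZero r}} →
  IsGeneralizedPartite G r →
  degreeBound G ≤ℝ fromℕ r
  × (fromℕ r ≃ℝ degreeBound G ⇔ (n % r ≡ 0 × IsRegular G (n * (r ∸ 1) / r)))
partite⇒degreeBound G (suc r) partite =
  degreeBound-≤ G partite , degreeBound-≡⇔regular G partite

theorem1p1 : ∀ (n : ℕ) .{{_ : NonZero n}} (G : Graph n) →
    let instance φ≢0 = φ-nonZero G in
    degreeBound G ≤ℝ fromℕ (φ G)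
    × (fromℕ (φ G) ≃ℝ degreeBound G
    ⇔ (n % φ G ≡ 0 × IsRegular G (n * (φ G ∸ 1) / φ G)))
theorem1p1 n G = partite⇒degreeBound G (φ G) {{φ-nonZero G}} (proj₁ (φ-isLeast G))
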